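{- Fix an integer $k\ge 2$. The numbers $S^{III}(n;m',u')$ with $m',u'\in\{0,1\}$ enumerate the following generalized lattice paths. (1) $S^{III}(n;0,0)$ is the number of $k$-Dyck paths of size $n$. (2) $S^{III}(n;0,1)$ is the number of $k$-Dyck paths of size $n$ with two types of up steps, namely $S^{III}(n;0,1)=2^{n}|\mathtt{Dyck}(n;k)|$. (3) $S^{III}(n;1,0)$ is the number of paths from $(0,0)$ to $((k+1)n,0)$ which stay in the first quadrant (axes included) and in which each step is $(1,k)$, $(2,k-1)$ or $(1,-1)$. (4) $S^{III}(n;1,1)$ is the weighted sum over $k$-Dyck paths $\mu$ of size $n$, where the path $\mu$ has weight $4^{\mathrm{Peak}(\mu)}3^{n-\mathrm{Peak}(\mu)}$.
   Context: Let $\kappa(m,r,s,u)$ (written $\kappa(r)$) be the formal power series in $r$ satisfying $\kappa(r)=1-rs(m-1)\prod_{j=0}^{k-1}\kappa(rs^{j})-rs(m(u-1)+1)\prod_{j=0}^{k}\kappa(rs^{j})$. With $m'=m-1$ and $u'=u-1$, define $S^{III}(n;m',u')=(-1)^n[r^n]\,\kappa$ evaluated at $s=1$, $m=m'+1$, $u=u'+1$. A $k$-Dyck path of size $n$ is a lattice path from $(0,0)$ to $(kn,n)$ consisting of up steps $U=(0,1)$ and down steps $D=(1,0)$ which never goes below the line $y=x/k$; $\mathtt{Dyck}(n;k)$ is the set of them. $\mathrm{Peak}(\mu)$ is the number of occurrences of the pattern $UD$ (consecutive steps) in $\mu$. -}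

module Defs where

open import Algebra.Bundles.Raw using (RawRing)
import Algebra.Definitions.RawSemiring as RawSemiringOps
open import Data.Bool.Base using (Bool)
open import Data.Fin.Base as Fin using (Fin; toℕ)
import Data.Fin.Properties as Fin
open import Data.Integer.Base as ℤ using (ℤ; +_; 0ℤ; 1ℤ; -1ℤ)
open import Data.List.Base using (List; []; _∷_; length; map; foldl; foldr)
open import Data.List.Membership.Propositional using (_∈_)
open import Data.List.Relation.Unary.All using (All)
open import Data.List.Relation.Unary.Unique.Propositional using (Unique)
open import Data.Nat.Base as ℕ using (ℕ; zero; suc; _∸_; _<_; s≤s; z≤n)
open import Data.Nat.ListAction using (sum)
import Data.Nat.Properties as ℕ
open import Data.Product.Base using (∃-syntax; _×_; _,_)
open import Data.Sum.Base using (inj₁; inj₂)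
open import Function.Base using (_∘_)
open import Function.Bundles using (_⇔_)
open import Level using (Level; 0ℓ)
open import Relation.Binary.PropositionalEquality
  using (_≡_; refl; sym; trans; cong; cong₂)

private variable
  c ℓ : Level

-- A[x].  The polynomial Σᵢ aᵢ xⁱ is the list a₀ ∷ a₁ ∷ …; lists that differ
-- by trailing zeros are identified by _≈_, which compares coefficients.
module Polynomial (A : RawRing c ℓ) where
  open RawRing A

  coeff : List Carrier → ℕ → Carrier
  coeff []      _       = 0#
  coeff (a ∷ _) zero    = a
  coeff (_ ∷ p) (suc i) = coeff p i

  add : List Carrier → List Carrier → List Carrier
  add []      q       = q
  add (a ∷ p) []      = a ∷ p
  add (a ∷ p) (b ∷ q) = (a + b) ∷ add p q

  -- (a + x p) q = a q + x (p q)
  mul : List Carrier → List Carrier → List Carrier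
  mul []      _ = []
  mul (a ∷ p) q = add (map (a *_) q) (0# ∷ mul p q)

  const : Carrier → List Carrier
  const a = a ∷ []

  X : List Carrier
  X = 0# ∷ 1# ∷ []

  rawRing : RawRing c ℓ
  rawRing = record
    { Carrier = List Carrier
    ; _≈_     = λ p q → ∀ i → coeff p i ≈ coeff q i
    ; _+_     = add
    ; _*_     = mul
    ; -_      = map (-_)
    ; 0#      = []
    ; 1#      = const 1#
    }

-- Σᵢ φ(aᵢ) xⁱ, by Horner's rule.
evalWith : {A : Set c} → (A → ℤ) → ℤ → List A → ℤ
evalWith φ x = foldr (λ a v → φ a ℤ.+ x ℤ.* v) 0ℤ

-- A[[r]], a power series being its sequence of coefficients.
module PowerSeries (A : RawRing c ℓ) where
  open RawRing A
  open RawSemiringOps rawSemiring renaming (sum to ∑; _^_ to _^ᴬ_)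

  const : Carrier → ℕ → Carrier
  const a zero    = a
  const a (suc _) = 0#

  X : ℕ → Carrier
  X 1 = 1#
  X _ = 0#

  rawRing : RawRing c ℓ
  rawRing = record
    { Carrier = ℕ → Carrier
    ; _≈_     = λ f g → ∀ n → f n ≈ g n
    ; _+_     = λ f g n → f n + g n
    ; _*_     = λ f g n → ∑ {suc n} λ i → f (toℕ i) * g (n ∸ toℕ i)
    ; -_      = λ f n → - f n
    ; 0#      = const 0#
    ; 1#      = const 1#
    }

  -- f(r) ↦ f(r a)
  dilate : Carrier → (ℕ → Carrier) → (ℕ → Carrier)
  dilate a f n = (a ^ᴬ n) * f n

-- ℤ[m,s,u] as ((ℤ[m])[s])[u]
module ℤ[m]     = Polynomial ℤ.+-*-rawRing
module ℤ[m,s]   = Polynomial ℤ[m].rawRing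
module ℤ[m,s,u] = Polynomial ℤ[m,s].rawRing

Coefficients : RawRing 0ℓ 0ℓ
Coefficients = ℤ[m,s,u].rawRing

Poly : Set
Poly = RawRing.Carrier Coefficients

𝐦 𝐬 𝐮 : Poly
𝐦 = ℤ[m,s,u].const (ℤ[m,s].const ℤ[m].X)
𝐬 = ℤ[m,s,u].const ℤ[m,s].X
𝐮 = ℤ[m,s,u].X

evaluate : (m s u : ℤ) → Poly → ℤ
evaluate m s u = evalWith (evalWith (evalWith (λ a → a) m) s) u

module ℤ[m,s,u]⟦r⟧ = PowerSeries Coefficients

Series : RawRing 0ℓ 0ℓ
Series = ℤ[m,s,u]⟦r⟧.rawRing

PowerSeriesInR : Set
PowerSeriesInR = RawRing.Carrier Series

module _ where
  open RawRing Coefficients using () renaming (_+_ to _+ᶜ_; _*_ to _*ᶜ_; -_ to ⊖ᶜ_; 1# to 1ᶜ)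
  open RawSemiringOps (RawRing.rawSemiring Coefficients) using () renaming (_^_ to _^ᶜ_)
  open RawRing Series
  open RawSemiringOps rawSemiring using (product)
  open ℤ[m,s,u]⟦r⟧ using (const; dilate) renaming (X to 𝐫)

  private
    _-_ : PowerSeriesInR → PowerSeriesInR → PowerSeriesInR
    f - g = f + (- g)

    _-ᶜ_ : Poly → Poly → Poly
    p -ᶜ q = p +ᶜ (⊖ᶜ q)

    infixl 6 _-_ _-ᶜ_

  rs⟨m-1⟩ rs⟨m⟨u-1⟩+1⟩ : PowerSeriesInR
  rs⟨m-1⟩      = 𝐫 * const (𝐬 *ᶜ (𝐦 -ᶜ 1ᶜ))
  rs⟨m⟨u-1⟩+1⟩ = 𝐫 * const (𝐬 *ᶜ ((𝐦 *ᶜ (𝐮 -ᶜ 1ᶜ)) +ᶜ 1ᶜ))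

  -- ∏_{j=0}^{l-1} κ(r sʲ)
  ∏dilates : ℕ → PowerSeriesInR → PowerSeriesInR
  ∏dilates l κ = product {l} λ j → dilate (𝐬 ^ᶜ toℕ j) κ

  rhs : ℕ → PowerSeriesInR → PowerSeriesInR
  rhs k κ = 1# - rs⟨m-1⟩ * ∏dilates k κ - rs⟨m⟨u-1⟩+1⟩ * ∏dilates (suc k) κ

  IsKappa : ℕ → PowerSeriesInR → Set
  IsKappa k κ = κ ≈ rhs k κ

-- The equation has a solution: rhs k is a contraction for the r-adic topology,
-- and its fixed point is the limit of the iterates of rhs k.
private
  module C = RawRing Coefficients
  module S = RawRing Series
  open RawSemiringOps C.rawSemiring using (_^_)

  Agree : ℕ → PowerSeriesInR → PowerSeriesInR → Set
  Agree N f g = ∀ n → n < N → f n ≡ g n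

  sum-cong : ∀ n {f g : Fin n → Poly} → (∀ i → f i ≡ g i) →
             RawSemiringOps.sum C.rawSemiring f ≡ RawSemiringOps.sum C.rawSemiring g
  sum-cong zero    f≡g = refl
  sum-cong (suc n) f≡g = cong₂ C._+_ (f≡g Fin.zero) (sum-cong n (f≡g ∘ Fin.suc))

  *-agree : ∀ {N f f′ g g′} → Agree N f f′ → Agree N g g′ →
            Agree N (f S.* g) (f′ S.* g′)
  *-agree f~ g~ n n<N = sum-cong (suc n) λ i → cong₂ C._*_
    (f~ (toℕ i) (ℕ.≤-<-trans (ℕ.≤-pred (Fin.toℕ<n i)) n<N))
    (g~ (n ∸ toℕ i) (ℕ.≤-<-trans (ℕ.m∸n≤m n (toℕ i)) n<N))

  product-agree : ∀ {N} l {f g : Fin l → PowerSeriesInR} → (∀ j → Agree N (f j) (g j)) →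
                  Agree N (RawSemiringOps.product S.rawSemiring f)
                          (RawSemiringOps.product S.rawSemiring g)
  product-agree zero    f~g n _ = refl
  product-agree (suc l) f~g = *-agree (f~g Fin.zero) (product-agree l (f~g ∘ Fin.suc))

  ∏dilates-agree : ∀ {N} l {f g} → Agree N f g → Agree N (∏dilates l f) (∏dilates l g)
  ∏dilates-agree l f~g = product-agree l λ j n n<N →
    cong (((𝐬 ^ toℕ j) ^ n) C.*_) (f~g n n<N)

  -- a series a with zero constant term raises the order of agreement
  raise : ∀ {N} a {f g} → a 0 ≡ [] → Agree N f g → Agree (suc N) (a S.* f) (a S.* g)
  raise a {f} {g} a₀ f~g n n<1+N = cong₂ C._+_
    (trans (cong (C._* f n) a₀) (sym (cong (C._* g n) a₀)))
    (sum-cong n λ i → cong (a (suc (toℕ i)) C.*_)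
      (f~g _ (ℕ.<-≤-trans (ℕ.∸-monoʳ-< (s≤s z≤n) (Fin.toℕ<n i)) (ℕ.≤-pred n<1+N))))

  rhs-agree : ∀ k {N f g} → Agree N f g → Agree (suc N) (rhs k f) (rhs k g)
  rhs-agree k f~g n n< = cong₂ C._+_
    (cong (λ p → S.1# n C.+ (C.- p)) (raise rs⟨m-1⟩ refl (∏dilates-agree k f~g) n n<))
    (cong C.-_ (raise rs⟨m⟨u-1⟩+1⟩ refl (∏dilates-agree (suc k) f~g) n n<))

  iter : ℕ → ℕ → PowerSeriesInR
  iter k zero    = S.0#
  iter k (suc N) = rhs k (iter k N)

  iter-step : ∀ k N → Agree N (iter k N) (iter k (suc N))
  iter-step k (suc N) = rhs-agree k (iter-step k N)

  stable : ∀ k N n → n < N → iter k (suc n) n ≡ iter k N n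
  stable k (suc N) n (s≤s n≤N) with ℕ.m≤n⇒m<n∨m≡n n≤N
  ... | inj₁ n<N  = trans (stable k N n n<N) (iter-step k N n n<N)
  ... | inj₂ refl = refl

κ-exists : ∀ k → ∃[ κ ] IsKappa k κ
κ-exists k = κ , λ n i j l → cong (coeffs i j l)
    (rhs-agree k {f = iter k n} {g = κ} (λ i i<n → sym (stable k n i i<n)) n ℕ.≤-refl)
  where
  κ : PowerSeriesInR
  κ n = iter k (suc n) n
  coeffs : ℕ → ℕ → ℕ → Poly → ℤ
  coeffs i j l p = ℤ[m].coeff (ℤ[m,s].coeff (ℤ[m,s,u].coeff p i) j) l

-- S^{III}(n; m′, u′)
S³ : PowerSeriesInR → (n : ℕ) (m′ u′ : ℤ) → ℤ
S³ κ n m′ u′ = -1ℤ ℤ.^ n ℤ.* evaluate (m′ ℤ.+ 1ℤ) 1ℤ (u′ ℤ.+ 1ℤ) (κ n)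

Point : Set
Point = ℤ × ℤ

_⊕_ : Point → Point → Point
(x , y) ⊕ (a , b) = x ℤ.+ a , y ℤ.+ b

vertices : {A : Set} → (A → Point) → Point → List A → List Point
vertices δ p []      = p ∷ []
vertices δ p (a ∷ w) = p ∷ vertices δ (p ⊕ δ a) w

-- The words w of steps (with displacements δ) that lead from the origin to b
-- within the region R.  Only the vertices of the path are required to lie in R:
-- the regions below are convex, so the segments between them then lie in R too.
record IsPath {A : Set} (δ : A → Point) (b : Point) (R : Point → Set) (w : List A) : Set where
  constructor isPath
  field
    ends  : foldl (λ p a → p ⊕ δ a) (0ℤ , 0ℤ) w ≡ b
    stays : All R (vertices δ (0ℤ , 0ℤ) w)

data Step : Set where
  U D : Step

displacement : Step → Point
displacement U = 0ℤ , 1ℤ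
displacement D = 1ℤ , 0ℤ

-- y ≥ x/k, with the denominator cleared (k is positive)
NotBelowLine : ℕ → Point → Set
NotBelowLine k (x , y) = x ℤ.≤ + k ℤ.* y

IsDyck : (k n : ℕ) → List Step → Set
IsDyck k n = IsPath displacement (+ k ℤ.* + n , + n) (NotBelowLine k)

peaks : List Step → ℕ
peaks (U ∷ D ∷ w) = suc (peaks w)
peaks (_ ∷ w)     = peaks w
peaks []          = 0

-- For a path of size n the subtraction does not truncate: it has n up steps,
-- so at most n peaks.
peakWeight : ℕ → List Step → ℕ
peakWeight n w = 4 ℕ.^ peaks w ℕ.* 3 ℕ.^ (n ∸ peaks w)

-- Steps where the up steps come in two types.
data TypedStep : Set where
  U : Bool → TypedStep
  D : TypedStep

forgetType : TypedStep → Step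
forgetType (U _) = U
forgetType D     = D

IsTypedDyck : (k n : ℕ) → List TypedStep → Set
IsTypedDyck k n w = IsDyck k n (map forgetType w)

-- The steps (1,k), (2,k-1) and (1,-1).
data QuadrantStep : Set where
  rise longRise fall : QuadrantStep

quadrantDisplacement : ℕ → QuadrantStep → Point
quadrantDisplacement k rise     = 1ℤ , + k
quadrantDisplacement k longRise = + 2 , + k ℤ.- 1ℤ
quadrantDisplacement k fall     = 1ℤ , -1ℤ

FirstQuadrant : Point → Set
FirstQuadrant (x , y) = 0ℤ ℤ.≤ x × 0ℤ ℤ.≤ y

IsQuadrantPath : (k n : ℕ) → List QuadrantStep → Set
IsQuadrantPath k n =
  IsPath (quadrantDisplacement k) ((+ k ℤ.+ 1ℤ) ℤ.* + n , 0ℤ) FirstQuadrant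

record Enumerates {A : Set} (P : A → Set) (xs : List A) : Set where
  constructor enumerates
  field
    unique  : Unique xs
    members : ∀ x → x ∈ xs ⇔ P x

-- N is the number of x with P x.
Count : {A : Set} → (A → Set) → ℕ → Set
Count P N = ∃[ xs ] Enumerates P xs × length xs ≡ N

-- N is the sum of the weights ω x over all x with P x.
WeightedCount : {A : Set} → (A → Set) → (A → ℕ) → ℕ → Set
WeightedCount P ω N = ∃[ xs ] Enumerates P xs × sum (map ω xs) ≡ N

{-# OPTIONS --safe #-}
module Submission where

-- At s = 1 the series κ becomes a series K over ℤ with K = 1 - a r K^k - b r K^(k+1), where
-- a = m′ and b = (m′+1)u′ + 1.  Multiplying by K^h gives
--   K^(h+1) = K^h - a r K^(k+h) - b r K^(k+1+h),
-- so the numbers f(n,h) = (-1)^n [r^n] K^(h+1) satisfy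
--   f(n+1,h) = f(n+1,h-1) + a f(n,h+k-1) + b f(n,h+k),
-- (without the first summand if h = 0), which together with f(0,h) = 1 determines them.  With
-- the height k y - x of a point (x,y) of a k-Dyck path, the same recursion holds for the weighted
-- number of paths that start at height h, stay at height ≥ 0, end at height 0 and contain n
-- rises: remove the first step.  For the peak weights, U D leaves the height h+k-1 with
-- weight 4, and U not followed by D leaves a path from height h+k that does not begin with
-- D, with weight 3; hence a = 4 - 3 = 1 and b = 3.

open import Defs
open import Algebra.Bundles using (AbelianGroup)
open import Algebra.Bundles.Raw using (RawRing)
import Algebra.Definitions.RawSemiring as RawSemiringOps
open import Algebra.Morphism.Construct.Identity using (isRingHomomorphism)
open import Algebra.Morphism.Structures using (module RingMorphisms)
import Algebra.Properties.Group as GroupProperties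
open import Data.Bool.Base using (true; false)
open import Data.Fin.Base as Fin using (Fin; toℕ)
open import Data.Integer.Base as ℤ using (ℤ; +_; 0ℤ; 1ℤ; -1ℤ)
import Data.Integer.Properties as ℤ
open import Data.Integer.Tactic.RingSolver using (solve-∀)
open import Data.List.Base using (List; []; _∷_; _++_; map; foldl; length; concatMap)
open import Data.List.Membership.Propositional using (_∈_; lose; find)
open import Data.List.Membership.Propositional.Properties
  using (∈-map⁺; ∈-map⁻; ∈-++⁺ˡ; ∈-++⁺ʳ; ∈-++⁻; ∈-concatMap⁺; ∈-concatMap⁻)
open import Data.List.Properties
  using (∷-injectiveˡ; ∷-injectiveʳ; length-map; length-++; map-++; map-∘; ++-identityʳ)
open import Data.List.Relation.Unary.All as All using (All; []; _∷_)
import Data.List.Relation.Unary.All.Properties as All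
open import Data.List.Relation.Unary.AllPairs as AllPairs using ([]; _∷_)
import Data.List.Relation.Unary.AllPairs.Properties as AllPairs
open import Data.List.Relation.Unary.Any using (here; there)
open import Data.List.Relation.Unary.Unique.Propositional using (Unique)
import Data.List.Relation.Unary.Unique.Propositional.Properties as Unique
open import Data.Nat.Base as ℕ using (ℕ; zero; suc; _≤_; _*_; _^_; _∸_; s≤s; z≤n)
open import Data.Nat.ListAction using (sum)
open import Data.Nat.ListAction.Properties using (sum-++)
import Data.Nat.Properties as ℕ
import Data.Nat.Tactic.RingSolver as ℕ-Solver
open import Data.Product.Base using (_×_; ∃-syntax; _,_; proj₁; proj₂)
open import Data.Sum.Base using (inj₁; inj₂)
open import Function.Base using (_∘_)
open import Function.Bundles using (_⇔_; mk⇔)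
import Function.Properties.Equivalence as ⇔
open import Level using (0ℓ)
open import Relation.Binary.PropositionalEquality
  using (_≡_; _≢_; _≗_; refl; sym; trans; cong; cong₂; subst; subst₂; module ≡-Reasoning)
open import Relation.Nullary.Negation using (¬_)

open ≡-Reasoning

ℤ-rawRing : RawRing 0ℓ 0ℓ
ℤ-rawRing = ℤ.+-*-rawRing

IsHom : (A : RawRing 0ℓ 0ℓ) → (RawRing.Carrier A → ℤ) → Set
IsHom A = RingMorphisms.IsRingHomomorphism A ℤ-rawRing

-- Evaluation of polynomials

module Evaluation {A : RawRing 0ℓ 0ℓ} {φ : RawRing.Carrier A → ℤ} (φ-hom : IsHom A φ) (x : ℤ) where
  open RawRing A using () renaming (Carrier to C; _*_ to _*ᴬ_; 0# to 0ᴬ; -_ to -ᴬ_)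
  open RingMorphisms.IsRingHomomorphism φ-hom
  open Polynomial A

  ev : List C → ℤ
  ev = evalWith φ x

  -- One polynomial is represented by lists of several lengths. Where one list has ended, the
  -- remaining coefficients of the other have image 0, and Horner's rule gives 0 on them.
  ev-cong : ∀ p q → (∀ i → φ (coeff p i) ≡ φ (coeff q i)) → ev p ≡ ev q
  ev-cong []      []      p≈q = refl
  ev-cong []      (b ∷ q) p≈q = sym (begin
    φ b ℤ.+ x ℤ.* ev q  ≡⟨ cong₂ (λ c v → c ℤ.+ x ℤ.* v) (sym (trans (sym 0#-homo) (p≈q 0)))
                                 (sym (ev-cong [] q (p≈q ∘ suc))) ⟩
    0ℤ ℤ.+ x ℤ.* 0ℤ     ≡⟨ trans (ℤ.+-identityˡ _) (ℤ.*-zeroʳ x) ⟩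
    0ℤ                  ∎)
  ev-cong (a ∷ p) []      p≈q = begin
    φ a ℤ.+ x ℤ.* ev p  ≡⟨ cong₂ (λ c v → c ℤ.+ x ℤ.* v) (trans (p≈q 0) 0#-homo)
                                 (ev-cong p [] (p≈q ∘ suc)) ⟩
    0ℤ ℤ.+ x ℤ.* 0ℤ     ≡⟨ trans (ℤ.+-identityˡ _) (ℤ.*-zeroʳ x) ⟩
    0ℤ                  ∎
  ev-cong (a ∷ p) (b ∷ q) p≈q =
    cong₂ (λ c v → c ℤ.+ x ℤ.* v) (p≈q 0) (ev-cong p q (p≈q ∘ suc))

  ev-add : ∀ p q → ev (add p q) ≡ ev p ℤ.+ ev q
  ev-add []      q       = sym (ℤ.+-identityˡ (ev q))
  ev-add (a ∷ p) []      = sym (ℤ.+-identityʳ (ev (a ∷ p)))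
  ev-add (a ∷ p) (b ∷ q) = trans
    (cong₂ (λ c v → c ℤ.+ x ℤ.* v) (+-homo a b) (ev-add p q))
    (rearrange (φ a) (φ b) x (ev p) (ev q))
    where
    rearrange : ∀ a b x p q → (a ℤ.+ b) ℤ.+ x ℤ.* (p ℤ.+ q) ≡ (a ℤ.+ x ℤ.* p) ℤ.+ (b ℤ.+ x ℤ.* q)
    rearrange = solve-∀

  ev-scale : ∀ a q → ev (map (a *ᴬ_) q) ≡ φ a ℤ.* ev q
  ev-scale a []      = sym (ℤ.*-zeroʳ (φ a))
  ev-scale a (b ∷ q) = trans
    (cong₂ (λ c v → c ℤ.+ x ℤ.* v) (*-homo a b) (ev-scale a q))
    (rearrange (φ a) (φ b) x (ev q))
    where
    rearrange : ∀ a b x q → a ℤ.* b ℤ.+ x ℤ.* (a ℤ.* q) ≡ a ℤ.* (b ℤ.+ x ℤ.* q)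
    rearrange = solve-∀

  ev-mul : ∀ p q → ev (mul p q) ≡ ev p ℤ.* ev q
  ev-mul []      q = sym (ℤ.*-zeroˡ (ev q))
  ev-mul (a ∷ p) q = begin
    ev (add (map (a *ᴬ_) q) (0ᴬ ∷ mul p q))
      ≡⟨ ev-add (map (a *ᴬ_) q) (0ᴬ ∷ mul p q) ⟩
    ev (map (a *ᴬ_) q) ℤ.+ (φ 0ᴬ ℤ.+ x ℤ.* ev (mul p q))
      ≡⟨ cong₂ ℤ._+_ (ev-scale a q) (cong₂ (λ c v → c ℤ.+ x ℤ.* v) 0#-homo (ev-mul p q)) ⟩
    φ a ℤ.* ev q ℤ.+ (0ℤ ℤ.+ x ℤ.* (ev p ℤ.* ev q))
      ≡⟨ rearrange (φ a) x (ev p) (ev q) ⟩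
    (φ a ℤ.+ x ℤ.* ev p) ℤ.* ev q ∎
    where
    rearrange : ∀ a x p q → a ℤ.* q ℤ.+ (0ℤ ℤ.+ x ℤ.* (p ℤ.* q)) ≡ (a ℤ.+ x ℤ.* p) ℤ.* q
    rearrange = solve-∀

  ev-const : ∀ a → ev (const a) ≡ φ a
  ev-const a = trans (cong (λ v → φ a ℤ.+ v) (ℤ.*-zeroʳ x)) (ℤ.+-identityʳ (φ a))

  ev-neg : ∀ p → ev (map -ᴬ_ p) ≡ ℤ.- ev p
  ev-neg []      = refl
  ev-neg (a ∷ p) = trans
    (cong₂ (λ c v → c ℤ.+ x ℤ.* v) (-‿homo a) (ev-neg p))
    (rearrange (φ a) x (ev p))
    where
    rearrange : ∀ a x p → ℤ.- a ℤ.+ x ℤ.* ℤ.- p ≡ ℤ.- (a ℤ.+ x ℤ.* p)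
    rearrange = solve-∀

  -- Input and output have the same form, so evaluation can be iterated through the tower of
  -- polynomial rings in `evaluate-isHom`, starting from the identity of ℤ.
  ev-isHom : IsHom rawRing ev
  ev-isHom = record
    { isSemiringHomomorphism = record
      { isNearSemiringHomomorphism = record
        { +-isMonoidHomomorphism = record
          { isMagmaHomomorphism = record
            { isRelHomomorphism = record { cong = λ {p} {q} p≈q → ev-cong p q (⟦⟧-cong ∘ p≈q) }
            ; homo = ev-add
            }
          ; ε-homo = refl
          }
        ; *-homo = ev-mul
        }
      ; 1#-homo = trans (ev-const _) 1#-homo
      }
    ; -‿homo = ev-neg
    }

evaluate-isHom : ∀ m s u → IsHom Coefficients (evaluate m s u)
evaluate-isHom m s u =
  Evaluation.ev-isHom (Evaluation.ev-isHom (Evaluation.ev-isHom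
    (isRingHomomorphism ℤ-rawRing refl) m) s) u

-- Power series over the integers

module ℤ⟦r⟧ = PowerSeries ℤ-rawRing

open RawRing ℤ⟦r⟧.rawRing using () renaming (_*_ to infixl 7 _⊛_; 1# to 𝟏; rawSemiring to ℤ⟦r⟧-rawSemiring)
open RawSemiringOps ℤ⟦r⟧-rawSemiring using () renaming (_^_ to infixr 8 _^ˢ_)

-- The sum in a product unfolds by computation: `(f ⊛ g) (suc n)` is `f 0 ℤ.* g (suc n)` plus
-- `((f ∘ suc) ⊛ g) n`. The inductions below on the index all peel off this summand and pass to
-- `f ∘ suc`; the stray `0ℤ` in the base cases is the empty rest of the sum.
⊛-cong : ∀ {f f′ g g′} → f ≗ f′ → g ≗ g′ → f ⊛ g ≗ f′ ⊛ g′
⊛-cong f≗ g≗ zero    = cong (ℤ._+ 0ℤ) (cong₂ ℤ._*_ (f≗ 0) (g≗ 0))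
⊛-cong f≗ g≗ (suc n) =
  cong₂ ℤ._+_ (cong₂ ℤ._*_ (f≗ 0) (g≗ (suc n))) (⊛-cong (f≗ ∘ suc) g≗ n)

⊛-distribʳ : ∀ f f′ g n → ((λ i → f i ℤ.+ f′ i) ⊛ g) n ≡ (f ⊛ g) n ℤ.+ (f′ ⊛ g) n
⊛-distribʳ f f′ g zero    = rearrange (f 0) (f′ 0) (g 0)
  where
  rearrange : ∀ a b c → (a ℤ.+ b) ℤ.* c ℤ.+ 0ℤ ≡ (a ℤ.* c ℤ.+ 0ℤ) ℤ.+ (b ℤ.* c ℤ.+ 0ℤ)
  rearrange = solve-∀
⊛-distribʳ f f′ g (suc n) = trans
  (cong (λ v → (f 0 ℤ.+ f′ 0) ℤ.* g (suc n) ℤ.+ v) (⊛-distribʳ (f ∘ suc) (f′ ∘ suc) g n))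
  (rearrange (f 0) (f′ 0) (g (suc n)) _ _)
  where
  rearrange : ∀ a b c u v → (a ℤ.+ b) ℤ.* c ℤ.+ (u ℤ.+ v) ≡ (a ℤ.* c ℤ.+ u) ℤ.+ (b ℤ.* c ℤ.+ v)
  rearrange = solve-∀

scale-⊛ : ∀ c f g n → ((λ i → c ℤ.* f i) ⊛ g) n ≡ c ℤ.* (f ⊛ g) n
scale-⊛ c f g zero    = rearrange c (f 0) (g 0)
  where
  rearrange : ∀ c a b → c ℤ.* a ℤ.* b ℤ.+ 0ℤ ≡ c ℤ.* (a ℤ.* b ℤ.+ 0ℤ)
  rearrange = solve-∀
scale-⊛ c f g (suc n) = trans
  (cong (λ v → c ℤ.* f 0 ℤ.* g (suc n) ℤ.+ v) (scale-⊛ c (f ∘ suc) g n))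
  (rearrange c (f 0) (g (suc n)) _)
  where
  rearrange : ∀ c a b u → c ℤ.* a ℤ.* b ℤ.+ c ℤ.* u ≡ c ℤ.* (a ℤ.* b ℤ.+ u)
  rearrange = solve-∀

-- The tail of `f ⊛ g` is `f 0` times the tail of `g`, plus the product of the tail of `f` with `g`.
-- Distributivity and scaling separate these two, and induction applies to the second.
⊛-assoc : ∀ f g h → (f ⊛ g) ⊛ h ≗ f ⊛ (g ⊛ h)
⊛-assoc f g h zero    = rearrange (f 0) (g 0) (h 0)
  where
  rearrange : ∀ a b c → (a ℤ.* b ℤ.+ 0ℤ) ℤ.* c ℤ.+ 0ℤ ≡ a ℤ.* (b ℤ.* c ℤ.+ 0ℤ) ℤ.+ 0ℤ
  rearrange = solve-∀
⊛-assoc f g h (suc n) = begin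
  (f 0 ℤ.* g 0 ℤ.+ 0ℤ) ℤ.* h (suc n) ℤ.+ ((λ i → f 0 ℤ.* g (suc i) ℤ.+ ((f ∘ suc) ⊛ g) i) ⊛ h) n
    ≡⟨ cong (λ v → (f 0 ℤ.* g 0 ℤ.+ 0ℤ) ℤ.* h (suc n) ℤ.+ v) (trans
         (⊛-distribʳ (λ i → f 0 ℤ.* g (suc i)) ((f ∘ suc) ⊛ g) h n)
         (cong₂ ℤ._+_ (scale-⊛ (f 0) (g ∘ suc) h n) (⊛-assoc (f ∘ suc) g h n))) ⟩
  (f 0 ℤ.* g 0 ℤ.+ 0ℤ) ℤ.* h (suc n) ℤ.+ (f 0 ℤ.* ((g ∘ suc) ⊛ h) n ℤ.+ ((f ∘ suc) ⊛ (g ⊛ h)) n)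
    ≡⟨ rearrange (f 0) (g 0) (h (suc n)) _ _ ⟩
  f 0 ℤ.* (g 0 ℤ.* h (suc n) ℤ.+ ((g ∘ suc) ⊛ h) n) ℤ.+ ((f ∘ suc) ⊛ (g ⊛ h)) n ∎
  where
  rearrange : ∀ a b c u v → (a ℤ.* b ℤ.+ 0ℤ) ℤ.* c ℤ.+ (a ℤ.* u ℤ.+ v) ≡ a ℤ.* (b ℤ.* c ℤ.+ u) ℤ.+ v
  rearrange = solve-∀

zero-⊛ : ∀ {f} g → (∀ i → f i ≡ 0ℤ) → ∀ n → (f ⊛ g) n ≡ 0ℤ
zero-⊛ g f≡0 zero    = cong (λ a → a ℤ.* g 0 ℤ.+ 0ℤ) (f≡0 0)
zero-⊛ g f≡0 (suc n) = cong₂ (λ a b → a ℤ.* g (suc n) ℤ.+ b) (f≡0 0) (zero-⊛ g (f≡0 ∘ suc) n)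

const-⊛ : ∀ c g n → (ℤ⟦r⟧.const c ⊛ g) n ≡ c ℤ.* g n
const-⊛ c g zero    = ℤ.+-identityʳ _
const-⊛ c g (suc n) =
  trans (cong (λ v → c ℤ.* g (suc n) ℤ.+ v) (zero-⊛ g (λ _ → refl) n)) (ℤ.+-identityʳ _)

𝟏-⊛ : ∀ g → 𝟏 ⊛ g ≗ g
𝟏-⊛ g n = trans (const-⊛ 1ℤ g n) (ℤ.*-identityˡ (g n))

X-⊛ : ∀ g n → (ℤ⟦r⟧.X ⊛ g) (suc n) ≡ g n
X-⊛ g n = trans (ℤ.+-identityˡ _) (trans (⊛-cong {g = g} X∘suc (λ _ → refl) n) (𝟏-⊛ g n))
  where
  X∘suc : ℤ⟦r⟧.X ∘ suc ≗ 𝟏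
  X∘suc zero    = refl
  X∘suc (suc _) = refl

infixr 7 _r⊛_
-- Bracketed like the terms `rs⟨m-1⟩ * ∏dilates k κ` of `rhs`, so that their images under
-- specialisation have this form directly.
_r⊛_ : ℤ → (ℕ → ℤ) → (ℕ → ℤ)
c r⊛ g = (ℤ⟦r⟧.X ⊛ ℤ⟦r⟧.const c) ⊛ g

r⊛-suc : ∀ c g n → (c r⊛ g) (suc n) ≡ c ℤ.* g n
r⊛-suc c g n = begin
  ((ℤ⟦r⟧.X ⊛ ℤ⟦r⟧.const c) ⊛ g) (suc n)  ≡⟨ ⊛-assoc ℤ⟦r⟧.X (ℤ⟦r⟧.const c) g (suc n) ⟩
  (ℤ⟦r⟧.X ⊛ (ℤ⟦r⟧.const c ⊛ g)) (suc n)  ≡⟨ X-⊛ (ℤ⟦r⟧.const c ⊛ g) n ⟩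
  (ℤ⟦r⟧.const c ⊛ g) n                   ≡⟨ const-⊛ c g n ⟩
  c ℤ.* g n                              ∎

^ˢ-+ : ∀ f i j → f ^ˢ i ⊛ f ^ˢ j ≗ f ^ˢ (i ℕ.+ j)
^ˢ-+ f zero    j   = 𝟏-⊛ (f ^ˢ j)
^ˢ-+ f (suc i) j n = trans (⊛-assoc f (f ^ˢ i) (f ^ˢ j) n)
                           (⊛-cong {f} (λ _ → refl) (^ˢ-+ f i j) n)

⊛-𝟏 : ∀ f → f ⊛ 𝟏 ≗ f
⊛-𝟏 f zero    = trans (ℤ.+-identityʳ _) (ℤ.*-identityʳ (f 0))
⊛-𝟏 f (suc n) = trans (cong₂ ℤ._+_ (ℤ.*-zeroʳ (f 0)) (⊛-𝟏 (f ∘ suc) n)) (ℤ.+-identityˡ _)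

-- Powers of a series that satisfies the algebraic equation

AlgebraicEquation : ℕ → ℤ → ℤ → (ℕ → ℤ) → Set
AlgebraicEquation k a b K =
  ∀ n → K n ≡ 𝟏 n ℤ.+ ℤ.- (a r⊛ K ^ˢ k) n ℤ.+ ℤ.- (b r⊛ K ^ˢ suc k) n

module AlgebraicSeries (k : ℕ) (a b : ℤ) (K : ℕ → ℤ) (K-eq : AlgebraicEquation k a b K) where

  K₀ : K 0 ≡ 1ℤ
  -- Both terms with a factor r have constant term 0 by computation.
  K₀ = K-eq 0

  ^ˢ₀ : ∀ h → (K ^ˢ h) 0 ≡ 1ℤ
  ^ˢ₀ zero    = refl
  ^ˢ₀ (suc h) = cong₂ (λ x y → x ℤ.* y ℤ.+ 0ℤ) K₀ (^ˢ₀ h)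

  ^ˢ-step : ∀ h n → (K ^ˢ suc h) (suc n) ≡
            (K ^ˢ h) (suc n) ℤ.+ ℤ.- (a ℤ.* (K ^ˢ (k ℕ.+ h)) n) ℤ.+ ℤ.- (b ℤ.* (K ^ˢ (suc k ℕ.+ h)) n)
  ^ˢ-step h n = begin
    (K ⊛ K ^ˢ h) (suc n)
      ≡⟨ ⊛-cong {g = K ^ˢ h} K-eq (λ _ → refl) (suc n) ⟩
    ((λ i → 𝟏 i ℤ.+ ℤ.- (a r⊛ K ^ˢ k) i ℤ.+ ℤ.- (b r⊛ K ^ˢ suc k) i) ⊛ K ^ˢ h) (suc n)
      ≡⟨ ⊛-distribʳ (λ i → 𝟏 i ℤ.+ ℤ.- (a r⊛ K ^ˢ k) i) (λ i → ℤ.- (b r⊛ K ^ˢ suc k) i) (K ^ˢ h) (suc n) ⟩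
    ((λ i → 𝟏 i ℤ.+ ℤ.- (a r⊛ K ^ˢ k) i) ⊛ K ^ˢ h) (suc n) ℤ.+ _
      ≡⟨ cong₂ ℤ._+_ (trans (⊛-distribʳ 𝟏 (λ i → ℤ.- (a r⊛ K ^ˢ k) i) (K ^ˢ h) (suc n))
           (cong₂ ℤ._+_ (𝟏-⊛ (K ^ˢ h) (suc n)) (summand a k))) (summand b (suc k)) ⟩
    _ ∎
    where
    summand : ∀ c l → ((λ i → ℤ.- (c r⊛ K ^ˢ l) i) ⊛ K ^ˢ h) (suc n) ≡ ℤ.- (c ℤ.* (K ^ˢ (l ℕ.+ h)) n)
    summand c l = begin
      ((λ i → ℤ.- (c r⊛ K ^ˢ l) i) ⊛ K ^ˢ h) (suc n)
        -- Negation is treated as scaling by -1, which `scale-⊛` moves out of the product.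
        ≡⟨ ⊛-cong {g = K ^ˢ h} (λ i → sym (ℤ.-1*i≡-i ((c r⊛ K ^ˢ l) i))) (λ _ → refl) (suc n) ⟩
      ((λ i → -1ℤ ℤ.* (c r⊛ K ^ˢ l) i) ⊛ K ^ˢ h) (suc n)
        ≡⟨ scale-⊛ -1ℤ (c r⊛ K ^ˢ l) (K ^ˢ h) (suc n) ⟩
      -1ℤ ℤ.* ((c r⊛ K ^ˢ l) ⊛ K ^ˢ h) (suc n)
        ≡⟨ ℤ.-1*i≡-i _ ⟩
      ℤ.- ((c r⊛ K ^ˢ l) ⊛ K ^ˢ h) (suc n)
        ≡⟨ cong ℤ.-_ (⊛-assoc (ℤ⟦r⟧.X ⊛ ℤ⟦r⟧.const c) (K ^ˢ l) (K ^ˢ h) (suc n)) ⟩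
      ℤ.- (c r⊛ (K ^ˢ l ⊛ K ^ˢ h)) (suc n)
        ≡⟨ cong ℤ.-_ (r⊛-suc c (K ^ˢ l ⊛ K ^ˢ h) n) ⟩
      ℤ.- (c ℤ.* (K ^ˢ l ⊛ K ^ˢ h) n)
        ≡⟨ cong (λ v → ℤ.- (c ℤ.* v)) (^ˢ-+ K l h n) ⟩
      ℤ.- (c ℤ.* (K ^ˢ (l ℕ.+ h)) n) ∎

open RawRing Coefficients using ()
  renaming (_+_ to infixl 6 _+ᶜ_; _*_ to infixl 7 _*ᶜ_; -_ to infix 8 -ᶜ_; 1# to 1ᶜ;
            rawSemiring to Coefficients-rawSemiring)

-- The constants inside `rs⟨m-1⟩` and `rs⟨m⟨u-1⟩+1⟩`; their values at s = 1 are m′ and (m′+1)u′ + 1.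
s⟨m-1⟩ s⟨m⟨u-1⟩+1⟩ : Poly
s⟨m-1⟩      = 𝐬 *ᶜ (𝐦 +ᶜ -ᶜ 1ᶜ)
s⟨m⟨u-1⟩+1⟩ = 𝐬 *ᶜ ((𝐦 *ᶜ (𝐮 +ᶜ -ᶜ 1ᶜ)) +ᶜ 1ᶜ)

-- The image of κ under specialisation of the coefficients

module Specialisation (φ : Poly → ℤ) (φ-hom : IsHom Coefficients φ) (φ𝐬≡1 : φ 𝐬 ≡ 1ℤ) where
  open RingMorphisms.IsRingHomomorphism φ-hom
  open RawRing Series using () renaming (_*_ to _*ˢ_; rawSemiring to Series-rawSemiring)
  open RawSemiringOps Coefficients-rawSemiring using () renaming (sum to ∑; _^_ to _^ᶜ_)
  open RawSemiringOps Series-rawSemiring using (product)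
  open ℤ[m,s,u]⟦r⟧ using (const; dilate) renaming (X to 𝐫)
  open RawSemiringOps ℤ.+-*-rawSemiring using () renaming (sum to ∑ᶻ)

  ∑-homo : ∀ n (f : Fin n → Poly) → φ (∑ f) ≡ ∑ᶻ (φ ∘ f)
  ∑-homo zero    f = 0#-homo
  ∑-homo (suc n) f = trans (+-homo _ _) (cong (λ v → φ (f Fin.zero) ℤ.+ v) (∑-homo n (f ∘ Fin.suc)))

  ∑ᶻ-cong : ∀ n {f g : Fin n → ℤ} → f ≗ g → ∑ᶻ f ≡ ∑ᶻ g
  ∑ᶻ-cong zero    f≗g = refl
  ∑ᶻ-cong (suc n) f≗g = cong₂ ℤ._+_ (f≗g Fin.zero) (∑ᶻ-cong n (f≗g ∘ Fin.suc))

  *ˢ-homo : ∀ f g → φ ∘ (f *ˢ g) ≗ (φ ∘ f) ⊛ (φ ∘ g)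
  *ˢ-homo f g n = trans (∑-homo (suc n) (λ i → f (toℕ i) *ᶜ g (n ∸ toℕ i)))
    (∑ᶻ-cong (suc n) λ i → *-homo (f (toℕ i)) (g (n ∸ toℕ i)))

  ^-homo-1 : ∀ {p} n → φ p ≡ 1ℤ → φ (p ^ᶜ n) ≡ 1ℤ
  ^-homo-1 zero    φp≡1 = 1#-homo
  ^-homo-1 {p} (suc n) φp≡1 = trans (*-homo p (p ^ᶜ n)) (cong₂ ℤ._*_ φp≡1 (^-homo-1 n φp≡1))

  𝟏-homo : φ ∘ RawRing.1# Series ≗ 𝟏
  𝟏-homo zero    = 1#-homo
  𝟏-homo (suc n) = 0#-homo

  dilate-homo : ∀ j κ → φ ∘ dilate (𝐬 ^ᶜ j) κ ≗ φ ∘ κ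
  dilate-homo j κ n = trans (*-homo ((𝐬 ^ᶜ j) ^ᶜ n) (κ n)) (trans
    (cong (ℤ._* φ (κ n)) (^-homo-1 n (^-homo-1 j φ𝐬≡1))) (ℤ.*-identityˡ _))

  -- Since φ sends 𝐬 to 1, every dilate of κ has the same image as κ. This turns the functional
  -- equation for κ into an algebraic one.
  ∏dilates-homo : ∀ l κ → φ ∘ ∏dilates l κ ≗ (φ ∘ κ) ^ˢ l
  ∏dilates-homo l κ = go l toℕ
    where
    -- The exponents are generalised because the product without its first factor runs over
    -- `toℕ ∘ Fin.suc` instead of `toℕ`.
    go : ∀ l (e : Fin l → ℕ) →
         φ ∘ product (λ j → dilate (𝐬 ^ᶜ e j) κ) ≗ (φ ∘ κ) ^ˢ l
    go zero    e   = 𝟏-homo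
    go (suc l) e n = trans
      (*ˢ-homo (dilate (𝐬 ^ᶜ e Fin.zero) κ) (product {l} λ j → dilate (𝐬 ^ᶜ e (Fin.suc j)) κ) n)
      (⊛-cong (dilate-homo (e Fin.zero) κ) (go l (e ∘ Fin.suc)) n)

  r-const-homo : ∀ c → φ ∘ (𝐫 *ˢ const c) ≗ ℤ⟦r⟧.X ⊛ ℤ⟦r⟧.const (φ c)
  r-const-homo c n = trans (*ˢ-homo 𝐫 (const c) n) (⊛-cong X-homo const-homo n)
    where
    X-homo : φ ∘ 𝐫 ≗ ℤ⟦r⟧.X
    X-homo 0             = 0#-homo
    X-homo 1             = 1#-homo
    X-homo (suc (suc _)) = 0#-homo
    const-homo : φ ∘ const c ≗ ℤ⟦r⟧.const (φ c)
    const-homo zero    = refl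
    const-homo (suc _) = 0#-homo

  κ-homo : ∀ k {κ} → IsKappa k κ → AlgebraicEquation k (φ s⟨m-1⟩) (φ s⟨m⟨u-1⟩+1⟩) (φ ∘ κ)
  κ-homo k {κ} κ-eq n = begin
    φ (κ n)
      ≡⟨ ⟦⟧-cong (κ-eq n) ⟩
    φ (RawRing.1# Series n +ᶜ -ᶜ A n +ᶜ -ᶜ B n)
      ≡⟨ trans (+-homo (RawRing.1# Series n +ᶜ -ᶜ A n) (-ᶜ B n))
               (cong (ℤ._+ φ (-ᶜ B n)) (+-homo (RawRing.1# Series n) (-ᶜ A n))) ⟩
    φ (RawRing.1# Series n) ℤ.+ φ (-ᶜ A n) ℤ.+ φ (-ᶜ B n)
      ≡⟨ cong₂ ℤ._+_ (cong₂ ℤ._+_ (𝟏-homo n) (summand s⟨m-1⟩ k)) (summand s⟨m⟨u-1⟩+1⟩ (suc k)) ⟩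
    𝟏 n ℤ.+ ℤ.- (φ s⟨m-1⟩ r⊛ (φ ∘ κ) ^ˢ k) n ℤ.+ ℤ.- (φ s⟨m⟨u-1⟩+1⟩ r⊛ (φ ∘ κ) ^ˢ suc k) n ∎
    where
    A B : PowerSeriesInR
    A = rs⟨m-1⟩ *ˢ ∏dilates k κ
    B = rs⟨m⟨u-1⟩+1⟩ *ˢ ∏dilates (suc k) κ
    summand : ∀ c l → φ (-ᶜ ((𝐫 *ˢ const c) *ˢ ∏dilates l κ) n)
                      ≡ ℤ.- (φ c r⊛ (φ ∘ κ) ^ˢ l) n
    summand c l = trans (-‿homo _) (cong ℤ.-_ (trans (*ˢ-homo (𝐫 *ˢ const c) (∏dilates l κ) n)
      (⊛-cong (r-const-homo c) (∏dilates-homo l κ) n)))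

-- The linear recursion obtained by removing the first step of a word

-- f n h is the weight of the words leading from height h to 0 through n rises; the parameter
-- of the equation for κ is k + 1.
record FirstStep (k a b : ℕ) (f : ℕ → ℕ → ℕ) : Set where
  field
    no-rise : ∀ h → f 0 h ≡ 1
    ground  : ∀ n → f (suc n) 0 ≡ a * f n (k ℕ.+ 0) ℕ.+ b * f n (suc k ℕ.+ 0)
    above   : ∀ n h → f (suc n) (suc h) ≡
              f (suc n) h ℕ.+ (a * f n (k ℕ.+ suc h) ℕ.+ b * f n (suc k ℕ.+ suc h))

-- Words with steps of prescribed heights

module Words {A : Set} (D : A) (rises : List A) (gain : A → ℕ) where

  -- Run n h w: the word w leads from height h to 0 through n rises.
  data Run : ℕ → ℕ → List A → Set where
    stop : Run 0 0 []
    fall : ∀ {n h w} → Run n h w → Run n (suc h) (D ∷ w)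
    rise : ∀ {n h a w} → a ∈ rises → Run n (gain a ℕ.+ h) w → Run (suc n) h (a ∷ w)

  -- The recursion is lexicographic: a fall keeps n and lowers h, a rise may raise h but lowers n.
  -- The words that begin with a rise form a list of their own, which the peak weights require
  -- later.
  paths rising : ℕ → ℕ → List (List A)
  paths n       (suc h) = map (D ∷_) (paths n h) ++ rising n (suc h)
  paths zero    zero    = [] ∷ []
  paths (suc n) zero    = rising (suc n) zero
  rising zero    h = []
  rising (suc n) h = concatMap (λ a → map (a ∷_) (paths n (gain a ℕ.+ h))) rises

  ∈-paths⁺ : ∀ {n h w} → Run n h w → w ∈ paths n h
  ∈-rising⁺ : ∀ {n h a w} → a ∈ rises → Run n (gain a ℕ.+ h) w → a ∷ w ∈ rising (suc n) h
  ∈-paths⁺ stop                   = here refl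
  ∈-paths⁺ (fall r)               = ∈-++⁺ˡ (∈-map⁺ (D ∷_) (∈-paths⁺ r))
  ∈-paths⁺ (rise {h = zero} a∈ r)  = ∈-rising⁺ a∈ r
  ∈-paths⁺ {suc n} (rise {h = suc h} a∈ r) =
    ∈-++⁺ʳ (map (D ∷_) (paths (suc n) h)) (∈-rising⁺ a∈ r)
  ∈-rising⁺ {a = a} a∈ r = ∈-concatMap⁺ (λ a → map (a ∷_) (paths _ (gain a ℕ.+ _)))
                             (lose a∈ (∈-map⁺ (a ∷_) (∈-paths⁺ r)))

  ∈-paths⁻ : ∀ n h {w} → w ∈ paths n h → Run n h w
  ∈-rising⁻ : ∀ n h {w} → w ∈ rising n h → Run n h w
  ∈-paths⁻ n (suc h) w∈ with ∈-++⁻ (map (D ∷_) (paths n h)) w∈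
  ... | inj₂ w∈rising = ∈-rising⁻ n (suc h) w∈rising
  ... | inj₁ w∈map with ∈-map⁻ (D ∷_) w∈map
  ...   | _ , v∈ , refl = fall (∈-paths⁻ n h v∈)
  ∈-paths⁻ zero    zero (here refl) = stop
  ∈-paths⁻ (suc n) zero w∈          = ∈-rising⁻ (suc n) zero w∈
  ∈-rising⁻ (suc n) h w∈
    with a , a∈ , w∈map ← find (∈-concatMap⁻ (λ a → map (a ∷_) (paths n (gain a ℕ.+ h))) {xs = rises} w∈)
    with _ , v∈ , refl ← ∈-map⁻ (a ∷_) w∈map = rise a∈ (∈-paths⁻ n (gain a ℕ.+ h) v∈)

  head∈rises : ∀ n h {a w} → a ∷ w ∈ rising n h → a ∈ rises
  head∈rises (suc n) h w∈
    with a , a∈ , w∈map ← find (∈-concatMap⁻ (λ a → map (a ∷_) (paths n (gain a ℕ.+ h))) {xs = rises} w∈)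
    with _ , _ , refl ← ∈-map⁻ (a ∷_) w∈map = a∈

  -- Words from different blocks of the list differ in their first letter, and words of one block
  -- differ in their tails, where induction applies.
  paths-unique : Unique (D ∷ rises) → ∀ n h → Unique (paths n h)
  rising-unique : Unique (D ∷ rises) → ∀ n h → Unique (rising n h)
  paths-unique u@(D∉rises ∷ _) n (suc h) =
    Unique.++⁺ (Unique.map⁺ ∷-injectiveʳ (paths-unique u n h)) (rising-unique u n (suc h)) disjoint
    where
    disjoint : ∀ {w} → ¬ (w ∈ map (D ∷_) (paths n h) × w ∈ rising n (suc h))
    disjoint (w∈map , w∈rising) with _ , _ , refl ← ∈-map⁻ (D ∷_) w∈map =
      All.lookup D∉rises (head∈rises n (suc h) w∈rising) refl
  paths-unique u zero    zero = [] ∷ []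
  paths-unique u (suc n) zero = rising-unique u (suc n) zero
  rising-unique u             zero    h = []
  rising-unique u@(_ ∷ rises!) (suc n) h = Unique.concat⁺
    (All.map⁺ (All.universal (λ a → Unique.map⁺ ∷-injectiveʳ (paths-unique u n (gain a ℕ.+ h))) rises))
    (AllPairs.map⁺ (AllPairs.map disjoint rises!))
    where
    disjoint : ∀ {a b} {xs ys : List (List A)} → a ≢ b →
               ∀ {w} → ¬ (w ∈ map (a ∷_) xs × w ∈ map (b ∷_) ys)
    disjoint {a} {b} a≢b (w∈ , w∈′)
      with _ , _ , refl ← ∈-map⁻ (a ∷_) w∈ | _ , _ , eq ← ∈-map⁻ (b ∷_) w∈′ = a≢b (∷-injectiveˡ eq)

  paths-enumerate : Unique (D ∷ rises) → ∀ {P : List A → Set} n h →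
                    (∀ w → Run n h w ⇔ P w) → Enumerates P (paths n h)
  paths-enumerate u n h Run⇔P = enumerates (paths-unique u n h)
    (λ w → ⇔.trans (mk⇔ (∈-paths⁻ n h) ∈-paths⁺) (Run⇔P w))

  number : ℕ → ℕ → ℕ
  number n h = length (paths n h)

  number-rising : ∀ n h →
    length (rising (suc n) h) ≡ sum (map (λ a → number n (gain a ℕ.+ h)) rises)
  number-rising n h = go rises
    where
    -- The induction runs over the letters tried first, while `paths` keeps the full alphabet.
    go : ∀ as → length (concatMap (λ a → map (a ∷_) (paths n (gain a ℕ.+ h))) as) ≡
                sum (map (λ a → number n (gain a ℕ.+ h)) as)
    go []       = refl
    go (a ∷ as) = trans (length-++ (map (a ∷_) (paths n (gain a ℕ.+ h))))
                        (cong₂ ℕ._+_ (length-map (a ∷_) (paths n (gain a ℕ.+ h))) (go as))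

  number-suc : ∀ n h → number n (suc h) ≡ number n h ℕ.+ length (rising n (suc h))
  number-suc n h = trans (length-++ (map (D ∷_) (paths n h)))
    (cong (ℕ._+ length (rising n (suc h))) (length-map (D ∷_) (paths n h)))

  number-0 : ∀ h → number 0 h ≡ 1
  number-0 zero    = refl
  number-0 (suc h) = trans (number-suc 0 h) (trans (ℕ.+-identityʳ _) (number-0 h))

  -- The condition says in effect that a letters gain k and b letters gain k + 1; as a sum over the
  -- concrete list `rises` it holds almost by computation in each application.
  number-firstStep : ∀ k a b →
    (∀ n h → sum (map (λ x → number n (gain x ℕ.+ h)) rises) ≡
             a * number n (k ℕ.+ h) ℕ.+ b * number n (suc k ℕ.+ h)) →
    FirstStep k a b number
  number-firstStep k a b rises≡ = record
    { no-rise = number-0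
    ; ground  = λ n → trans (number-rising n 0) (rises≡ n 0)
    ; above   = λ n h → trans (number-suc (suc n) h)
        (cong (λ v → number (suc n) h ℕ.+ v) (trans (number-rising n (suc h)) (rises≡ n (suc h))))
    }

-- Coefficients of the powers of an algebraic series

module _ (k a b : ℕ) (K : ℕ → ℤ) (K-eq : AlgebraicEquation (suc k) (+ a) (+ b) K) where
  open AlgebraicSeries (suc k) (+ a) (+ b) K K-eq

  signed : ℕ → ℕ → ℤ
  signed n h = -1ℤ ℤ.^ n ℤ.* (K ^ˢ h) n

  signed-step : ∀ n h → signed (suc n) (suc h) ≡
    signed (suc n) h ℤ.+ (+ a ℤ.* signed n (suc (k ℕ.+ h)) ℤ.+ + b ℤ.* signed n (suc (suc k ℕ.+ h)))
  signed-step n h = trans (cong (-1ℤ ℤ.^ suc n ℤ.*_) (^ˢ-step h n))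
    (rearrange (-1ℤ ℤ.^ n) (+ a) (+ b) _ _ _)
    where
    rearrange : ∀ s a b x y z →
      -1ℤ ℤ.* s ℤ.* (x ℤ.+ ℤ.- (a ℤ.* y) ℤ.+ ℤ.- (b ℤ.* z)) ≡
      -1ℤ ℤ.* s ℤ.* x ℤ.+ (a ℤ.* (s ℤ.* y) ℤ.+ b ℤ.* (s ℤ.* z))
    rearrange = solve-∀

  -- The recursion determines its solution, by induction on n and then on h: a rise leads to a
  -- greater height but to a smaller n. Height h corresponds to the exponent h + 1.
  signed≡ : ∀ {f} → FirstStep k a b f → ∀ n h → signed n (suc h) ≡ + f n h
  signed≡ {f} step = go
    where
    open FirstStep step
    go : ∀ n h → signed n (suc h) ≡ + f n h
    rises : ∀ n h →
      + a ℤ.* signed n (suc (k ℕ.+ h)) ℤ.+ + b ℤ.* signed n (suc (suc k ℕ.+ h)) ≡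
      + (a * f n (k ℕ.+ h) ℕ.+ b * f n (suc k ℕ.+ h))
    rises n h = cong₂ ℤ._+_
      (trans (cong (+ a ℤ.*_) (go n (k ℕ.+ h))) (sym (ℤ.pos-* a _)))
      (trans (cong (+ b ℤ.*_) (go n (suc k ℕ.+ h))) (sym (ℤ.pos-* b _)))
    go zero h = trans (cong (1ℤ ℤ.*_) (^ˢ₀ (suc h))) (cong +_ (sym (no-rise h)))
    go (suc n) zero = begin
      signed (suc n) 1                      ≡⟨ signed-step n 0 ⟩
      -- At height 0 the summand for a fall would come from K^0 = 1, whose coefficients of positive
      -- degree vanish.
      -1ℤ ℤ.^ suc n ℤ.* 0ℤ ℤ.+ _            ≡⟨ cong₂ ℤ._+_ (ℤ.*-zeroʳ (-1ℤ ℤ.^ suc n)) (rises n 0) ⟩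
      + (a * f n (k ℕ.+ 0) ℕ.+ b * f n (suc k ℕ.+ 0))  ≡⟨ cong +_ (ground n) ⟨
      + f (suc n) 0                         ∎
    go (suc n) (suc h) = begin
      signed (suc n) (suc (suc h))          ≡⟨ signed-step n (suc h) ⟩
      signed (suc n) (suc h) ℤ.+ _          ≡⟨ cong₂ ℤ._+_ (go (suc n) h) (rises n (suc h)) ⟩
      + (f (suc n) h ℕ.+ _)                 ≡⟨ cong +_ (above n h) ⟨
      + f (suc n) (suc h)                   ∎

-- The series K itself is the power with exponent 1, hence height 0. The three conditions on
-- `evaluate` are closed by `refl` once m′ and u′ are numerals. Writing the parameter as `suc k`
-- avoids a truncated subtraction in h + k - 1.
S³≡ : ∀ k {κ} → IsKappa (suc k) κ → ∀ n m′ u′ {a b f} → FirstStep k a b f →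
      evaluate (m′ ℤ.+ 1ℤ) 1ℤ (u′ ℤ.+ 1ℤ) 𝐬 ≡ 1ℤ →
      evaluate (m′ ℤ.+ 1ℤ) 1ℤ (u′ ℤ.+ 1ℤ) s⟨m-1⟩ ≡ + a →
      evaluate (m′ ℤ.+ 1ℤ) 1ℤ (u′ ℤ.+ 1ℤ) s⟨m⟨u-1⟩+1⟩ ≡ + b →
      S³ κ n m′ u′ ≡ + f n 0
S³≡ k {κ} κ-eq n m′ u′ {a} {b} {f} step 𝐬≡ a≡ b≡ = begin
  -1ℤ ℤ.^ n ℤ.* K n         ≡⟨ cong (-1ℤ ℤ.^ n ℤ.*_) (⊛-𝟏 K n) ⟨
  -1ℤ ℤ.^ n ℤ.* (K ^ˢ 1) n  ≡⟨ signed≡ k a b K K-eq step n 0 ⟩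
  + f n 0                   ∎
  where
  φ = evaluate (m′ ℤ.+ 1ℤ) 1ℤ (u′ ℤ.+ 1ℤ)
  K = φ ∘ κ
  K-eq : AlgebraicEquation (suc k) (+ a) (+ b) K
  K-eq = subst (λ b → AlgebraicEquation (suc k) (+ a) b K) b≡
    (subst (λ a → AlgebraicEquation (suc k) a (φ s⟨m⟨u-1⟩+1⟩) K) a≡
      (Specialisation.κ-homo φ (evaluate-isHom (m′ ℤ.+ 1ℤ) 1ℤ (u′ ℤ.+ 1ℤ)) 𝐬≡ (suc k) κ-eq))

-- From words to lattice paths

⊕-cancelʳ : ∀ d p q → p ⊕ d ≡ q ⊕ d → p ≡ q
⊕-cancelʳ (a , b) (x , y) (x′ , y′) eq =
  cong₂ _,_ (+-cancelʳ a x x′ (cong proj₁ eq)) (+-cancelʳ b y y′ (cong proj₂ eq))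
  where
  open GroupProperties (AbelianGroup.group ℤ.+-0-abelianGroup) using () renaming (∙-cancelʳ to +-cancelʳ)

module Geometry {A : Set} (D : A) (rises : List A) (gain : A → ℕ)
                (letters : ∀ a → a ∈ D ∷ rises) (δ : A → Point) where
  open Words D rises gain

  -- The paths to b in R with N rises are the runs from height 0: the current vertex of a path
  -- is determined by the number of rises still to come and the height above the boundary.
  record Layout (b : Point) (R : Point → Set) (N : ℕ) : Set where
    field
      pos          : ℕ → ℕ → Point
      pos-end      : pos 0 0 ≡ b
      pos-start    : pos N 0 ≡ (0ℤ , 0ℤ)
      start-unique : ∀ n h → pos n h ≡ (0ℤ , 0ℤ) → n ≡ N × h ≡ 0
      pos-fall     : ∀ n h → pos n (suc h) ⊕ δ D ≡ pos n h
      pos-rise     : ∀ {a} → a ∈ rises → ∀ n h → pos (suc n) h ⊕ δ a ≡ pos n (gain a ℕ.+ h)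
      start-in     : R (0ℤ , 0ℤ)
      fall-in      : ∀ n h → R (pos n (suc h)) → R (pos n h)
      rise-in      : ∀ {a} → a ∈ rises → ∀ n h → R (pos (suc n) h) → R (pos n (gain a ℕ.+ h))
      rise-bound   : ∀ {a} → a ∈ rises → ∀ p n h → R p → p ⊕ δ a ≡ pos n h → gain a ≤ h

  module _ {b R N} (layout : Layout b R N) where
    open Layout layout

    PathFrom : Point → List A → Set
    PathFrom p w = foldl (λ q a → q ⊕ δ a) p w ≡ b × All R (vertices δ p w)

    path-from : ∀ {n h w} → Run n h w → R (pos n h) → PathFrom (pos n h) w
    path-from stop r = pos-end , r ∷ []
    path-from (fall {n} {h} {w} run) r
      with ends , stays ← subst (λ p → PathFrom p w) (sym (pos-fall n h)) (path-from run (fall-in n h r))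
      = ends , r ∷ stays
    path-from (rise {n} {h} {a} {w} a∈ run) r
      with ends , stays ← subst (λ p → PathFrom p w) (sym (pos-rise a∈ n h)) (path-from run (rise-in a∈ n h r))
      = ends , r ∷ stays

    -- The indices n and h are known only at the end of the path, so they are carried backwards: the
    -- rest of the word gives them for the vertex after the step, and cancelling the displacement
    -- gives the vertex before it. Before a rise, `rise-bound` turns membership in R into a height
    -- that is a natural number.
    run-from : ∀ p w → PathFrom p w → ∃[ n ] ∃[ h ] p ≡ pos n h × Run n h w
    run-from p []      (ends , _) = 0 , 0 , trans ends (sym pos-end) , stop
    run-from p (a ∷ w) (ends , r ∷ stays) with run-from (p ⊕ δ a) w (ends , stays) | letters a
    ... | n , h , eq , run | here refl =
      n , suc h , ⊕-cancelʳ (δ D) p _ (trans eq (sym (pos-fall n h))) , fall run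
    ... | n , h , eq , run | there a∈ with h′ , refl ← ℕ.m≤n⇒∃[o]m+o≡n (rise-bound a∈ p n h r eq) =
      suc n , h′ , ⊕-cancelʳ (δ a) p _ (trans eq (sym (pos-rise a∈ n h′))) , rise a∈ run

    Run⇔IsPath : ∀ w → Run N 0 w ⇔ IsPath δ b R w
    Run⇔IsPath w = mk⇔ to from
      where
      to : Run N 0 w → IsPath δ b R w
      to run with ends , stays ← subst (λ p → PathFrom p w) pos-start
                    (path-from run (subst R (sym pos-start) start-in)) = isPath ends stays
      from : IsPath δ b R w → Run N 0 w
      from (isPath ends stays) with n , h , eq , run ← run-from (0ℤ , 0ℤ) w (ends , stays)
        with refl , refl ← start-unique n h (sym eq) = run

-- Dyck paths

module Dyck (k : ℕ) where
  open Words {Step} D (U ∷ []) (λ _ → k) public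

  steps-unique : Unique {A = Step} (D ∷ U ∷ [])
  steps-unique = ((λ ()) ∷ []) ∷ [] ∷ []

  steps : (a : Step) → a ∈ D ∷ U ∷ []
  steps D = here refl
  steps U = there (here refl)

  open Geometry {Step} D (U ∷ []) (λ _ → k) steps displacement

  layout : ∀ N → Layout (+ k ℤ.* + N , + N) (NotBelowLine k) N
  layout N = record
    { pos          = pos
    ; pos-end      = cong₂ _,_ (end-x (+ k) (+ N)) (ℤ.+-identityʳ (+ N))
    ; pos-start    = cong₂ _,_ (start-x (+ k) (+ N)) (ℤ.+-inverseʳ (+ N))
    ; start-unique = start-unique
    ; pos-fall     = λ n h → cong₂ _,_ (fall-x (+ k) (+ N) (+ n) (+ h)) (ℤ.+-identityʳ _)
    ; pos-rise     = λ { (here refl) n h →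
        cong₂ _,_ (rise-x (+ k) (+ N) (+ n) (+ h)) (rise-y (+ N) (+ n)) }
    ; start-in     = ℤ.≤-reflexive (sym (ℤ.*-zeroʳ (+ k)))
    ; fall-in      = λ n h _ → pos-in n h
    ; rise-in      = λ _ n h _ → pos-in n (k ℕ.+ h)
    -- Before the step U the height k y - x equals h - k, and `x≤ky` makes it nonnegative.
    ; rise-bound   = λ { (here refl) (x , y) n h x≤ky eq → ℤ.drop‿+≤+ (ℤ.0≤i-j⇒j≤i (subst (0ℤ ℤ.≤_)
        (begin
          + k ℤ.* y ℤ.- x
            ≡⟨ rearrange (+ k) x y ⟩
          + k ℤ.* (y ℤ.+ 1ℤ) ℤ.- (x ℤ.+ 0ℤ) ℤ.- + k
            ≡⟨ cong₂ (λ x y → + k ℤ.* y ℤ.- x ℤ.- + k) (cong proj₁ eq) (cong proj₂ eq) ⟩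
          + k ℤ.* (+ N ℤ.- + n) ℤ.- (+ k ℤ.* (+ N ℤ.- + n) ℤ.- + h) ℤ.- + k
            ≡⟨ cancel (+ k ℤ.* (+ N ℤ.- + n)) (+ h) (+ k) ⟩
          + h ℤ.- + k ∎)
        (ℤ.i≤j⇒0≤j-i x≤ky))) }
    }
    where
    -- With n up steps still to come y is N - n, and x is fixed by k y - x = h.
    pos : ℕ → ℕ → Point
    pos n h = + k ℤ.* (+ N ℤ.- + n) ℤ.- + h , + N ℤ.- + n

    pos-in : ∀ n h → NotBelowLine k (pos n h)
    pos-in n h = ℤ.i-j≤i (+ k ℤ.* (+ N ℤ.- + n)) (+ h)

    start-unique : ∀ n h → pos n h ≡ (0ℤ , 0ℤ) → n ≡ N × h ≡ 0
    start-unique n h eq = sym (ℤ.+-injective N≡n) , ℤ.+-injective (begin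
      + h                                        ≡⟨ isolate (+ k) (+ h) ⟩
      ℤ.- (+ k ℤ.* 0ℤ ℤ.- + h)                   ≡⟨ cong (λ y → ℤ.- (+ k ℤ.* y ℤ.- + h)) (cong proj₂ eq) ⟨
      ℤ.- (+ k ℤ.* (+ N ℤ.- + n) ℤ.- + h)        ≡⟨ cong (λ x → ℤ.- x) (cong proj₁ eq) ⟩
      0ℤ                                         ∎)
      where
      N≡n : + N ≡ + n
      N≡n = ℤ.i-j≡0⇒i≡j (+ N) (+ n) (cong proj₂ eq)
      isolate : ∀ k h → h ≡ ℤ.- (k ℤ.* 0ℤ ℤ.- h)
      isolate = solve-∀

    end-x : ∀ k N → k ℤ.* (N ℤ.- 0ℤ) ℤ.- 0ℤ ≡ k ℤ.* N
    end-x = solve-∀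
    start-x : ∀ k N → k ℤ.* (N ℤ.- N) ℤ.- 0ℤ ≡ 0ℤ
    start-x = solve-∀
    fall-x : ∀ k N n h → k ℤ.* (N ℤ.- n) ℤ.- (1ℤ ℤ.+ h) ℤ.+ 1ℤ ≡ k ℤ.* (N ℤ.- n) ℤ.- h
    fall-x = solve-∀
    rise-x : ∀ k N n h → k ℤ.* (N ℤ.- (1ℤ ℤ.+ n)) ℤ.- h ℤ.+ 0ℤ ≡ k ℤ.* (N ℤ.- n) ℤ.- (k ℤ.+ h)
    rise-x = solve-∀
    rise-y : ∀ N n → N ℤ.- (1ℤ ℤ.+ n) ℤ.+ 1ℤ ≡ N ℤ.- n
    rise-y = solve-∀
    rearrange : ∀ k x y → k ℤ.* y ℤ.- x ≡ k ℤ.* (y ℤ.+ 1ℤ) ℤ.- (x ℤ.+ 0ℤ) ℤ.- k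
    rearrange = solve-∀
    cancel : ∀ m h k → m ℤ.- (m ℤ.- h) ℤ.- k ≡ h ℤ.- k
    cancel = solve-∀

  Run⇔IsDyck : ∀ n w → Run n 0 w ⇔ IsDyck k n w
  Run⇔IsDyck n = Run⇔IsPath (layout n)

  dyck-count : ∀ n → Count (IsDyck k n) (number n 0)
  dyck-count n = paths n 0 , paths-enumerate steps-unique n 0 (Run⇔IsDyck n) , refl

  peaks-U : ∀ w → peaks (U ∷ w) ≤ suc (peaks w)
  peaks-U []      = z≤n
  peaks-U (U ∷ w) = ℕ.n≤1+n _
  peaks-U (D ∷ w) = ℕ.≤-refl

  -- Each peak uses up a rise of its own. The bound keeps the subtraction in `peakWeight` from
  -- truncating.
  peaks≤ : ∀ {n h w} → Run n h w → peaks w ≤ n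
  peaks≤ stop                             = z≤n
  peaks≤ (fall run)                       = peaks≤ run
  peaks≤ (rise {w = w} (here refl) run)   = ℕ.≤-trans (peaks-U w) (s≤s (peaks≤ run))

dyck-firstStep : ∀ k → FirstStep k 0 1 (Dyck.number (suc k))
dyck-firstStep k = Dyck.number-firstStep (suc k) k 0 1 (λ _ _ → refl)

-- Dyck paths with typed up steps

module TypedDyck (k : ℕ) where
  open Words {TypedStep} D (U false ∷ U true ∷ []) (λ _ → k) public
  private module Untyped = Dyck k

  steps-unique : Unique {A = TypedStep} (D ∷ U false ∷ U true ∷ [])
  steps-unique = ((λ ()) ∷ (λ ()) ∷ []) ∷ ((λ ()) ∷ []) ∷ [] ∷ []

  Run⇔IsTypedDyck : ∀ n w → Run n 0 w ⇔ IsTypedDyck k n w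
  Run⇔IsTypedDyck n w = ⇔.trans (mk⇔ forget (remember w)) (Untyped.Run⇔IsDyck n (map forgetType w))
    where
    forget : ∀ {n h w} → Run n h w → Untyped.Run n h (map forgetType w)
    forget stop                            = Untyped.stop
    forget (fall run)                      = Untyped.fall (forget run)
    forget (rise (here refl) run)          = Untyped.rise (here refl) (forget run)
    forget (rise (there (here refl)) run)  = Untyped.rise (here refl) (forget run)
    remember : ∀ {n h} w → Untyped.Run n h (map forgetType w) → Run n h w
    remember []            Untyped.stop                   = stop
    remember (D ∷ w)       (Untyped.fall run)             = fall (remember w run)
    remember (D ∷ w)       (Untyped.rise (here ()) run)
    remember (U false ∷ w) (Untyped.rise (here refl) run) = rise (here refl) (remember w run)
    remember (U true ∷ w)  (Untyped.rise (here refl) run) = rise (there (here refl)) (remember w run)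

  -- Both sides obey the same recursion on the first step: a rise has two types, which supplies one
  -- factor 2 for each of the n rises.
  number≡ : ∀ n h → number n h ≡ 2 ^ n * Untyped.number n h
  number-rising≡ : ∀ n h → length (rising (suc n) h) ≡ 2 ^ suc n * length (Untyped.rising (suc n) h)
  number≡ zero h = trans (number-0 h) (sym (trans (ℕ.+-identityʳ _) (Untyped.number-0 h)))
  number≡ (suc n) zero    = number-rising≡ n 0
  number≡ (suc n) (suc h) = begin
    number (suc n) (suc h)
      ≡⟨ number-suc (suc n) h ⟩
    number (suc n) h ℕ.+ length (rising (suc n) (suc h))
      ≡⟨ cong₂ ℕ._+_ (number≡ (suc n) h) (number-rising≡ n (suc h)) ⟩
    2 ^ suc n * Untyped.number (suc n) h ℕ.+ 2 ^ suc n * length (Untyped.rising (suc n) (suc h))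
      ≡⟨ ℕ.*-distribˡ-+ (2 ^ suc n) (Untyped.number (suc n) h) _ ⟨
    2 ^ suc n * (Untyped.number (suc n) h ℕ.+ length (Untyped.rising (suc n) (suc h)))
      ≡⟨ cong (2 ^ suc n *_) (Untyped.number-suc (suc n) h) ⟨
    2 ^ suc n * Untyped.number (suc n) (suc h) ∎
  number-rising≡ n h = begin
    length (rising (suc n) h)
      ≡⟨ number-rising n h ⟩
    2 * number n (k ℕ.+ h)
      ≡⟨ cong (2 *_) (number≡ n (k ℕ.+ h)) ⟩
    2 * (2 ^ n * Untyped.number n (k ℕ.+ h))
      ≡⟨ ℕ.*-assoc 2 (2 ^ n) _ ⟨
    2 ^ suc n * Untyped.number n (k ℕ.+ h)
      ≡⟨ cong (2 ^ suc n *_) (trans (Untyped.number-rising n h) (ℕ.+-identityʳ _)) ⟨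
    2 ^ suc n * length (Untyped.rising (suc n) h) ∎

  typedDyck-count : ∀ n → Count (IsTypedDyck k n) (2 ^ n * Untyped.number n 0)
  typedDyck-count n =
    paths n 0 , paths-enumerate steps-unique n 0 (Run⇔IsTypedDyck n) , number≡ n 0

typedDyck-firstStep : ∀ k → FirstStep k 0 2 (TypedDyck.number (suc k))
typedDyck-firstStep k = TypedDyck.number-firstStep (suc k) k 0 2 (λ _ _ → refl)

-- Paths in the first quadrant

-- The steps are those of the parameter k + 1; gain fall is a junk value.
module Quadrant (k : ℕ) where
  gain : QuadrantStep → ℕ
  gain rise     = suc k
  gain longRise = k
  gain fall     = 0

  -- `longRise` comes first so that the gains k and k + 1 appear in the order of a and b in
  -- `FirstStep`.
  open Words fall (longRise ∷ rise ∷ []) gain public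
    using (paths; paths-enumerate; number; number-firstStep)

  steps-unique : Unique (fall ∷ longRise ∷ rise ∷ [])
  steps-unique = ((λ ()) ∷ (λ ()) ∷ []) ∷ ((λ ()) ∷ []) ∷ [] ∷ []

  steps : ∀ a → a ∈ fall ∷ longRise ∷ rise ∷ []
  steps fall     = here refl
  steps longRise = there (here refl)
  steps rise     = there (there (here refl))

  δ : QuadrantStep → Point
  δ = quadrantDisplacement (suc k)

  open Geometry fall (longRise ∷ rise ∷ []) gain steps δ

  δ-height : ∀ {a} → a ∈ longRise ∷ rise ∷ [] → proj₂ (δ a) ≡ + gain a
  δ-height (here refl)         = refl
  δ-height (there (here refl)) = refl

  δ-width : ∀ a → 0ℤ ℤ.≤ proj₁ (δ a)
  δ-width rise     = ℤ.+≤+ z≤n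
  δ-width longRise = ℤ.+≤+ z≤n
  δ-width fall     = ℤ.+≤+ z≤n

  layout : ∀ N → Layout ((+ suc k ℤ.+ 1ℤ) ℤ.* + N , 0ℤ) FirstQuadrant N
  layout N = record
    { pos          = pos
    ; pos-end      = cong (_, 0ℤ) (end-x (+ suc k) (+ N))
    ; pos-start    = cong (_, 0ℤ) (start-x (+ suc k) (+ N))
    ; start-unique = start-unique
    ; pos-fall     = pos-fall
    ; pos-rise     = pos-rise
    ; start-in     = ℤ.≤-refl , ℤ.≤-refl
    ; fall-in      = λ n h → advance fall (pos-fall n h)
    ; rise-in      = λ {a} a∈ n h → advance a (pos-rise a∈ n h)
    ; rise-bound   = λ {a} a∈ → λ { (x , y) n h (_ , 0≤y) eq → ℤ.drop‿+≤+
        (subst₂ ℤ._≤_ (ℤ.+-identityˡ (+ gain a))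
          (trans (cong (λ d → y ℤ.+ d) (sym (δ-height a∈))) (cong proj₂ eq))
          (ℤ.+-monoˡ-≤ (+ gain a) 0≤y)) }
    }
    where
    -- Here the height is y. Both kinds of rise add k + 2 to x + y and a fall leaves it unchanged,
    -- so x + y is (k + 2)(N - n).
    pos : ℕ → ℕ → Point
    pos n h = (+ suc k ℤ.+ 1ℤ) ℤ.* (+ N ℤ.- + n) ℤ.- + h , + h

    end-x : ∀ k N → (k ℤ.+ 1ℤ) ℤ.* (N ℤ.- 0ℤ) ℤ.- 0ℤ ≡ (k ℤ.+ 1ℤ) ℤ.* N
    end-x = solve-∀
    start-x : ∀ k N → (k ℤ.+ 1ℤ) ℤ.* (N ℤ.- N) ℤ.- 0ℤ ≡ 0ℤ
    start-x = solve-∀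
    fall-x : ∀ k N n h → (k ℤ.+ 1ℤ) ℤ.* (N ℤ.- n) ℤ.- (1ℤ ℤ.+ h) ℤ.+ 1ℤ ≡
                         (k ℤ.+ 1ℤ) ℤ.* (N ℤ.- n) ℤ.- h
    fall-x = solve-∀
    longRise-x : ∀ k N n h →
      ((1ℤ ℤ.+ k) ℤ.+ 1ℤ) ℤ.* (N ℤ.- (1ℤ ℤ.+ n)) ℤ.- h ℤ.+ + 2 ≡
      ((1ℤ ℤ.+ k) ℤ.+ 1ℤ) ℤ.* (N ℤ.- n) ℤ.- (k ℤ.+ h)
    longRise-x = solve-∀
    rise-x : ∀ k N n h → (k ℤ.+ 1ℤ) ℤ.* (N ℤ.- (1ℤ ℤ.+ n)) ℤ.- h ℤ.+ 1ℤ ≡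
                         (k ℤ.+ 1ℤ) ℤ.* (N ℤ.- n) ℤ.- (k ℤ.+ h)
    rise-x = solve-∀

    pos-fall : ∀ n h → pos n (suc h) ⊕ δ fall ≡ pos n h
    pos-fall n h = cong (_, + h) (fall-x (+ suc k) (+ N) (+ n) (+ h))

    pos-rise : ∀ {a} → a ∈ longRise ∷ rise ∷ [] → ∀ n h →
               pos (suc n) h ⊕ δ a ≡ pos n (gain a ℕ.+ h)
    pos-rise (here refl)         n h =
      cong₂ _,_ (longRise-x (+ k) (+ N) (+ n) (+ h)) (ℤ.+-comm (+ h) (+ k))
    pos-rise (there (here refl)) n h =
      cong₂ _,_ (rise-x (+ suc k) (+ N) (+ n) (+ h)) (ℤ.+-comm (+ h) (+ suc k))

    -- No step decreases x, and the new y is a natural number.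
    advance : ∀ a {p x h} → p ⊕ δ a ≡ (x , + h) → FirstQuadrant p → FirstQuadrant (x , + h)
    advance a eq (0≤x , _) = subst (0ℤ ℤ.≤_) (cong proj₁ eq) (ℤ.+-mono-≤ 0≤x (δ-width a)) , ℤ.+≤+ z≤n

    start-unique : ∀ n h → pos n h ≡ (0ℤ , 0ℤ) → n ≡ N × h ≡ 0
    start-unique n h eq with refl ← ℤ.+-injective (cong proj₂ eq)
      with ℤ.i*j≡0⇒i≡0∨j≡0 (+ suc k ℤ.+ 1ℤ) (trans (sym (ℤ.+-identityʳ _)) (cong proj₁ eq))
    -- The other factor, `+ suc k ℤ.+ 1ℤ`, is visibly nonzero, which leaves this case alone.
    ... | inj₂ N-n≡0 = sym (ℤ.+-injective (ℤ.i-j≡0⇒i≡j (+ N) (+ n) N-n≡0)) , refl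

  quadrant-count : ∀ n → Count (IsQuadrantPath (suc k) n) (number n 0)
  quadrant-count n = paths n 0 , paths-enumerate steps-unique n 0 (Run⇔IsPath (layout n)) , refl

quadrant-firstStep : ∀ k → FirstStep k 1 1 (Quadrant.number k)
quadrant-firstStep k = number-firstStep k 1 1 λ n h →
  cong (ℕ._+ 1 * number n (suc k ℕ.+ h)) (sym (ℕ.+-identityʳ (number n (k ℕ.+ h))))
  where open Quadrant k

-- Dyck paths weighted by their peaks

sum-map-scale : ∀ {A : Set} {f g : A → ℕ} c {xs} → All (λ x → f x ≡ c * g x) xs →
                sum (map f xs) ≡ c * sum (map g xs)
sum-map-scale c []                = sym (ℕ.*-zeroʳ c)
sum-map-scale {g = g} c {x ∷ xs} (eq ∷ eqs) = trans
  (cong₂ ℕ._+_ eq (sum-map-scale c eqs)) (sym (ℕ.*-distribˡ-+ c (g x) (sum (map g xs))))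

module PeakWeight (k : ℕ) where
  open Dyck (suc k)

  total : ℕ → List (List Step) → ℕ
  total n ws = sum (map (peakWeight n) ws)

  weight : ℕ → ℕ → ℕ
  weight n h = total n (paths n h)

  total-++ : ∀ n vs ws → total n (vs ++ ws) ≡ total n vs ℕ.+ total n ws
  total-++ n vs ws = trans (cong sum (map-++ (peakWeight n) vs ws)) (sum-++ (map (peakWeight n) vs) _)

  weight-suc : ∀ n h → weight n (suc h) ≡ weight n h ℕ.+ total n (rising n (suc h))
  weight-suc n h = trans (total-++ n (map (D ∷_) (paths n h)) _)
    (cong (λ ws → sum ws ℕ.+ total n (rising n (suc h))) (sym (map-∘ (paths n h))))

  -- The new peak raises n and the number of peaks by one each, so the exponent of 3 stays and that
  -- of 4 grows.
  total-UD : ∀ n ws → total (suc n) (map (U ∷_) (map (D ∷_) ws)) ≡ 4 * total n ws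
  total-UD n ws = trans (cong sum (trans (sym (map-∘ (map (D ∷_) ws))) (sym (map-∘ ws))))
    (sum-map-scale 4 (All.universal (λ w → ℕ.*-assoc 4 (4 ^ peaks w) (3 ^ (n ∸ peaks w))) ws))

  -- Words of `rising` begin with U, so a further U in front creates no peak and only the exponent
  -- of 3 grows.
  total-UU : ∀ n h → total (suc n) (map (U ∷_) (rising n h)) ≡ 3 * total n (rising n h)
  total-UU zero    h = refl
  total-UU (suc n) h = trans (cong sum (sym (map-∘ (rising (suc n) h))))
    (sum-map-scale 3 (All.++⁺ (All.map⁺ (All.tabulate λ {w} → triple w)) []))
    where
    commute : ∀ a b → a * (3 * b) ≡ 3 * (a * b)
    commute = ℕ-Solver.solve-∀
    triple : ∀ w → w ∈ paths n (suc k ℕ.+ h) →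
             peakWeight (suc (suc n)) (U ∷ U ∷ w) ≡ 3 * peakWeight (suc n) (U ∷ w)
    triple w w∈ = trans
      -- The exponent of 3 grows by exactly one because p is at most the number `suc n` of rises in
      -- `U ∷ w`.
      (cong (λ e → 4 ^ p * 3 ^ e) (ℕ.+-∸-assoc 1 (peaks≤ (rise {h = h} (here refl) (∈-paths⁻ n _ w∈)))))
      (commute (4 ^ p) (3 ^ (suc n ∸ p)))
      where
      p : ℕ
      p = peaks (U ∷ w)

  -- An initial U is a peak, of weight 4 instead of 3, iff the path continues with D.
  total-rising : ∀ n h → total (suc n) (rising (suc n) h) ≡
                 1 * weight n (k ℕ.+ h) ℕ.+ 3 * weight n (suc k ℕ.+ h)
  total-rising n h = begin
    total (suc n) (map (U ∷_) (paths n (suc k ℕ.+ h)) ++ [])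
      ≡⟨ cong (total (suc n)) (trans (++-identityʳ _) (map-++ (U ∷_) (map (D ∷_) (paths n m)) (rising n (suc m)))) ⟩
    total (suc n) (map (U ∷_) (map (D ∷_) (paths n m)) ++ map (U ∷_) (rising n (suc m)))
      ≡⟨ total-++ (suc n) (map (U ∷_) (map (D ∷_) (paths n m))) _ ⟩
    total (suc n) (map (U ∷_) (map (D ∷_) (paths n m))) ℕ.+ total (suc n) (map (U ∷_) (rising n (suc m)))
      ≡⟨ cong₂ ℕ._+_ (total-UD n (paths n m)) (total-UU n (suc m)) ⟩
    4 * weight n m ℕ.+ 3 * total n (rising n (suc m))
      -- Three of the four copies of `weight n m` complete the words beginning with U to all words
      -- from height m + 1; one copy remains, hence a = 1 and b = 3.
      ≡⟨ rearrange (weight n m) (total n (rising n (suc m))) ⟩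
    1 * weight n m ℕ.+ 3 * (weight n m ℕ.+ total n (rising n (suc m)))
      ≡⟨ cong (λ v → 1 * weight n m ℕ.+ 3 * v) (weight-suc n m) ⟨
    1 * weight n m ℕ.+ 3 * weight n (suc m) ∎
    where
    m : ℕ
    m = k ℕ.+ h
    rearrange : ∀ a b → 4 * a ℕ.+ 3 * b ≡ 1 * a ℕ.+ 3 * (a ℕ.+ b)
    rearrange = ℕ-Solver.solve-∀

  peakWeight-firstStep : FirstStep k 1 3 weight
  peakWeight-firstStep = record
    { no-rise = no-rise
    ; ground  = λ n → total-rising n 0
    ; above   = λ n h → trans (weight-suc (suc n) h) (cong (λ v → weight (suc n) h ℕ.+ v) (total-rising n (suc h)))
    }
    where
    no-rise : ∀ h → weight 0 h ≡ 1
    no-rise zero    = refl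
    no-rise (suc h) = trans (weight-suc 0 h) (trans (ℕ.+-identityʳ _) (no-rise h))

  peakWeight-count : ∀ n → WeightedCount (IsDyck (suc k) n) (peakWeight n) (weight n 0)
  peakWeight-count n = paths n 0 , paths-enumerate steps-unique n 0 (Run⇔IsDyck n) , refl

proposition4p31 : (k : ℕ) → 2 ≤ k → (κ : PowerSeriesInR) → IsKappa k κ → (n : ℕ) →
    (∃[ N ] Count (IsDyck k n) N × S³ κ n (+ 0) (+ 0) ≡ + N) ×
    (∃[ N ] Count (IsDyck k n) N × Count (IsTypedDyck k n) (2 ^ n * N) × S³ κ n (+ 0) (+ 1) ≡ + (2 ^ n * N)) ×
    (∃[ N ] Count (IsQuadrantPath k n) N × S³ κ n (+ 1) (+ 0) ≡ + N) ×
    (∃[ N ] WeightedCount (IsDyck k n) (peakWeight n) N × S³ κ n (+ 1) (+ 1) ≡ + N)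
-- With a = m′ and b = (m′+1)u′ + 1 the four cases have (a, b) = (0, 1), (0, 2), (1, 1) and (1, 3).
proposition4p31 (suc k) _ κ κ-eq n =
  (_ , Dyck.dyck-count (suc k) n
     , S³≡ k κ-eq n (+ 0) (+ 0) (dyck-firstStep k) refl refl refl) ,
  (_ , Dyck.dyck-count (suc k) n , TypedDyck.typedDyck-count (suc k) n
     , trans (S³≡ k κ-eq n (+ 0) (+ 1) (typedDyck-firstStep k) refl refl refl)
             (cong +_ (TypedDyck.number≡ (suc k) n 0))) ,
  (_ , Quadrant.quadrant-count k n
     , S³≡ k κ-eq n (+ 1) (+ 0) (quadrant-firstStep k) refl refl refl) ,
  (_ , PeakWeight.peakWeight-count k n
     , S³≡ k κ-eq n (+ 1) (+ 1) (PeakWeight.peakWeight-firstStep k) refl refl refl)
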